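{- The proof system $\mathbf{SC}_{\min}$ is complete with respect to the class of minimal simplicial models, and the proof system $\mathbf{SC}_{\max}$ is complete with respect to the class of maximal simplicial models: every formula of $\mathcal L_D$ true at every world of every minimal (resp. maximal) simplicial model is provable in $\mathbf{SC}_{\min}$ (resp. $\mathbf{SC}_{\max}$).
   Context: Fix a finite set $A$ of agents and a countable set $\mathsf{AP}$. $\mathcal L_D$: $\varphi::=p\mid\neg\varphi\mid\varphi\wedge\varphi\mid D_B\varphi$, $p\in\mathsf{AP}$, $\emptyset\ne B\subseteq A$; $K_a\varphi:=D_{\{a\}}\varphi$, $\mathsf{dead}(a):=K_a\bot$, $\mathsf{alive}(a):=\neg\mathsf{dead}(a)$, $\mathsf{dead}(B):=\bigwedge_{a\in B}\mathsf{dead}(a)$ (empty conjunction $=\top$), $\mathsf{alive}(B):=\neg D_B\bot$, $\overline B=A\setminus B$. $\mathbf{SC}$: propositional tautologies, modus ponens, necessitation (from $\varphi$ infer $D_B\varphi$), and for non-empty $B,B'$: $D_B(\varphi\Rightarrow\psi)\Rightarrow(D_B\varphi\Rightarrow D_B\psi)$; $\varphi\Rightarrow D_B\neg D_B\neg\varphi$; $D_B\varphi\Rightarrow D_BD_B\varphi$; $D_B\varphi\Rightarrow D_{B'}\varphi$ ($B\subseteq B'$); $\mathsf{alive}(B)\wedge\mathsf{alive}(B')\Rightarrow\mathsf{alive}(B\cup B')$; $\bigvee_{a\in A}\mathsf{alive}(a)$; $\mathsf{alive}(B)\wedge\mathsf{dead}(\overline B)\wedge\varphi\Rightarrow D_B(\mathsf{dead}(\overline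 B)\Rightarrow\varphi)$. $\mathbf{SC}_{\min}$ is $\mathbf{SC}$ plus $\mathsf{alive}(B)\wedge\mathsf{dead}(\overline B)\Rightarrow D_B\mathsf{dead}(\overline B)$ for $B\subsetneq A$; $\mathbf{SC}_{\max}$ is $\mathbf{SC}$ plus $\mathsf{alive}(B)\Rightarrow\neg D_B\neg\mathsf{dead}(\overline B)$ for $B\subsetneq A$. A chromatic simplicial complex is $\langle V,S,\chi\rangle$ with $S$ a family of non-empty subsets of $V$ containing all singletons and closed under non-empty subsets, $\chi:V\to A$ injective on each simplex. A generalized simplicial model is $\mathcal C=\langle V,S,\chi,W,\ell\rangle$ with $\mathrm{Facets}\subseteq W\subseteq S$ and $\ell:W\to\mathcal P(\mathsf{AP})$; minimal if $W$ is the set of facets (maximal simplices), maximal if $W=S$. Satisfaction: $\mathcal C,w\models p$ iff $p\in\ell(w)$; boolean clauses standard; $\mathcal C,w\models D_B\varphi$ iff $\mathcal C,w'\models\varphi$ for all $w'\in W$ with $B\subseteq\chi(w\cap w')$. -}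

module Defs where

open import Data.Nat using (ℕ; zero)
open import Data.Bool using (Bool; true; false; not; _∧_; if_then_else_)
open import Data.Fin using (Fin)
open import Data.Fin.Subset using (Subset; _∈_; Nonempty; ⁅_⁆; ∁; _∪_) renaming (_⊆_ to _⊆ˢ_)
open import Data.Fin.Subset.Properties using (x∈⁅x⁆; p⊆p∪q)
open import Data.Vec using (lookup)
open import Data.List using (List; foldr; allFin)
open import Data.Product using (Σ; ∃; _×_; _,_)
open import Data.Empty using (⊥)
open import Relation.Nullary using (¬_; yes; no)
open import Relation.Binary.PropositionalEquality using (_≡_)
open import Level using (Level) renaming (suc to lsuc; zero to lzero)

-- Language L_D over agents A = Fin n and atoms AP = ℕ.
-- D B φ is only formed for non-empty B (irrelevant non-emptiness proof).

data Form (n : ℕ) : Set where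
  atom : ℕ → Form n
  ¬ᶠ_  : Form n → Form n
  _∧ᶠ_ : Form n → Form n → Form n
  D    : (B : Subset n) → .(Nonempty B) → Form n → Form n

infixr 6 _∧ᶠ_

module _ {n : ℕ} where

  infixr 5 _∨ᶠ_
  infixr 4 _⇒_

  -- fixed falsum / verum (AP is non-empty, atom 0 exists)
  ⊥ᶠ : Form n
  ⊥ᶠ = atom 0 ∧ᶠ ¬ᶠ atom 0

  ⊤ᶠ : Form n
  ⊤ᶠ = ¬ᶠ ⊥ᶠ

  _∨ᶠ_ : Form n → Form n → Form n
  φ ∨ᶠ ψ = ¬ᶠ (¬ᶠ φ ∧ᶠ ¬ᶠ ψ)

  _⇒_ : Form n → Form n → Form n
  φ ⇒ ψ = ¬ᶠ (φ ∧ᶠ ¬ᶠ ψ)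

  K : Fin n → Form n → Form n
  K a φ = D ⁅ a ⁆ (a , x∈⁅x⁆ a) φ

  dead : Fin n → Form n
  dead a = K a ⊥ᶠ

  alive : Fin n → Form n
  alive a = ¬ᶠ dead a

  deadS : Subset n → Form n
  deadS B = foldr (λ a acc → if isIn a then dead a ∧ᶠ acc else acc) ⊤ᶠ (allFin n)
    where
    isIn : Fin n → Bool
    isIn a = lookup B a

  aliveS : (B : Subset n) → .(Nonempty B) → Form n
  aliveS B ne = ¬ᶠ D B ne ⊥ᶠ

  someAlive : Form n
  someAlive = foldr (λ a acc → alive a ∨ᶠ acc) ⊥ᶠ (allFin n)

  evalB : (Form n → Bool) → Form n → Bool
  evalB v (atom i)    = v (atom i)
  evalB v (¬ᶠ φ)      = not (evalB v φ)
  evalB v (φ ∧ᶠ ψ)    = evalB v φ ∧ evalB v ψ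
  evalB v (D B ne φ)  = v (D B ne φ)

  Tautology : Form n → Set
  Tautology φ = ∀ (v : Form n → Bool) → evalB v φ ≡ true

data Variant : Set where
  min max : Variant

data _⊢_ {n : ℕ} (s : Variant) : Form n → Set where
  taut  : ∀ {φ} → Tautology φ → s ⊢ φ
  mp    : ∀ {φ ψ} → s ⊢ (φ ⇒ ψ) → s ⊢ φ → s ⊢ ψ
  nec   : ∀ {φ} B .(ne : Nonempty B) → s ⊢ φ → s ⊢ D B ne φ
  axK   : ∀ B .(ne : Nonempty B) φ ψ →
          s ⊢ (D B ne (φ ⇒ ψ) ⇒ (D B ne φ ⇒ D B ne ψ))
  axB   : ∀ B .(ne : Nonempty B) φ →
          s ⊢ (φ ⇒ D B ne (¬ᶠ D B ne (¬ᶠ φ)))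
  ax4   : ∀ B .(ne : Nonempty B) φ →
          s ⊢ (D B ne φ ⇒ D B ne (D B ne φ))
  axMono : ∀ B B' .(ne : Nonempty B) .(ne' : Nonempty B') φ → B ⊆ˢ B' →
          s ⊢ (D B ne φ ⇒ D B' ne' φ)
  axUnion : ∀ B B' .(ne : Nonempty B) .(ne' : Nonempty B') .(ne∪ : Nonempty (B ∪ B')) →
          s ⊢ (aliveS B ne ∧ᶠ aliveS B' ne' ⇒ aliveS (B ∪ B') ne∪)
  axAlive : s ⊢ someAlive
  axDead : ∀ B .(ne : Nonempty B) φ →
          s ⊢ (aliveS B ne ∧ᶠ deadS (∁ B) ∧ᶠ φ ⇒ D B ne (deadS (∁ B) ⇒ φ))
  axMin : s ≡ min → ∀ B .(ne : Nonempty B) → Nonempty (∁ B) →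
          s ⊢ (aliveS B ne ∧ᶠ deadS (∁ B) ⇒ D B ne (deadS (∁ B)))
  axMax : s ≡ max → ∀ B .(ne : Nonempty B) → Nonempty (∁ B) →
          s ⊢ (aliveS B ne ⇒ ¬ᶠ D B ne (¬ᶠ deadS (∁ B)))

Pred : Set → Set₁
Pred V = V → Set

_⊆_ : ∀ {V : Set} → Pred V → Pred V → Set
X ⊆ Y = ∀ {v} → X v → Y v

_≐_ : ∀ {V : Set} → Pred V → Pred V → Set
X ≐ Y = (X ⊆ Y) × (Y ⊆ X)

NonEmptyP : ∀ {V : Set} → Pred V → Set
NonEmptyP {V} X = Σ V X

record Model (n : ℕ) : Set₁ where
  field
    V   : Set
    χ   : V → Fin n
    S   : Pred V → Set
    S-nonempty  : ∀ X → S X → NonEmptyP X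
    S-singleton : ∀ v → S (λ u → u ≡ v)
    S-down      : ∀ X Y → S X → Y ⊆ X → NonEmptyP Y → S Y
    chromatic   : ∀ X → S X → ∀ u v → X u → X v → χ u ≡ χ v → u ≡ v

  Facet : Pred V → Set₁
  Facet X = S X × (∀ Y → S Y → X ⊆ Y → Y ⊆ X)

  field
    W   : Pred V → Set
    W-resp    : ∀ X Y → X ≐ Y → W X → W Y
    facet⊆W   : ∀ X → Facet X → W X
    W⊆S       : ∀ X → W X → S X
    ℓ   : Pred V → ℕ → Set
    ℓ-resp    : ∀ X Y p → X ≐ Y → ℓ X p → ℓ Y p

open Model public

IsMinimal : ∀ {n} → Model n → Set₁
IsMinimal M = ∀ X → W M X → Facet M X

IsMaximal : ∀ {n} → Model n → Set₁
IsMaximal M = ∀ X → S M X → W M X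

_⊆χ_∩_ : ∀ {n} {M : Model n} → Subset n → Pred (V M) → Pred (V M) → Set
_⊆χ_∩_ {M = M} B w w' = ∀ a → a ∈ B → Σ (V M) λ v → w v × w' v × χ M v ≡ a

_,_⊨_ : ∀ {n} (M : Model n) → Pred (V M) → Form n → Set₁
M , w ⊨ atom p   = Level.Lift _ (ℓ M w p)
M , w ⊨ (¬ᶠ φ)   = ¬ (M , w ⊨ φ)
M , w ⊨ (φ ∧ᶠ ψ) = (M , w ⊨ φ) × (M , w ⊨ ψ)
M , w ⊨ D B _ φ  = ∀ w' → W M w' → _⊆χ_∩_ {M = M} B w w' → M , w' ⊨ φ

ValidMin : ∀ {n} → Form n → Set₁
ValidMin {n} φ = ∀ (M : Model n) → IsMinimal M → ∀ w → W M w → M , w ⊨ φ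

ValidMax : ∀ {n} → Form n → Set₁
ValidMax {n} φ = ∀ (M : Model n) → IsMaximal M → ∀ w → W M w → M , w ⊨ φ

{-# OPTIONS --safe #-}
module Submission where

-- Validity must yield an actual derivation, so instead of maximal consistent sets one starts
-- from all valuations of a finite set Γ of atoms and boxes, and repeatedly discards those that
-- falsify one of finitely many theorems, or that make some ¬ D B ψ true without a witness among
-- the remaining valuations. The disjunction of the characteristic formulas of the remaining
-- valuations stays provable, so a formula true at all survivors is derivable. The survivors
-- form a finite frame in which D B is interpreted by a partial equivalence R B, monotone in B.
-- Unravelling it into a tree of paths, where crossing an edge labelled B keeps exactly the
-- vertices coloured by B, gives a simplicial model: paths sharing their B-vertices are
-- R B-related, since the edges between them all contain B. Here axDead determines the atoms at
-- a simplex with exactly the agents B alive, axMin forces path simplices to be facets, and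
-- axMax provides a path for every face of a simplex.

open import Defs
open import Data.Bool using (Bool; true; false; not; _∧_; if_then_else_)
import Data.Bool.Properties as Bool
open import Data.Fin using (Fin)
open import Data.Fin.Properties using (any?; sequence)
open import Data.Fin.Subset using (Subset; Nonempty; ⁅_⁆; ∁; _∪_; inside; outside)
  renaming (_∈_ to _∈ˢ_; _∉_ to _∉ˢ_; _⊆_ to _⊆ˢ_)
open import Data.Fin.Subset.Properties
  using (x∈⁅x⁆; x∈⁅y⁆⇒x≡y; nonempty?; p⊆p∪q; q⊆p∪q; x∈∁p⇒x∉p; x∉p⇒x∈∁p)
  renaming (_∈?_ to _∈ˢ?_; _⊆?_ to _⊆ˢ?_)
open import Data.List as List
  using (List; []; _∷_; _++_; map; foldr; filter; concatMap; cartesianProductWith; allFin; length)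
open import Data.List.Membership.Propositional using (_∈_; find; lose)
open import Data.List.Membership.Propositional.Properties
  using (∈-++⁺ˡ; ∈-++⁺ʳ; ∈-++⁻; ∈-allFin; ∈-filter⁺; ∈-map⁺; ∈-concatMap⁺; ∈-concatMap⁻;
         ∈-cartesianProductWith⁺)
open import Data.List.Properties using (filter-notAll)
open import Data.List.Relation.Binary.Subset.Propositional using () renaming (_⊆_ to _⊆ᴸ_)
open import Data.List.Relation.Unary.All as All using (All; []; _∷_)
import Data.List.Relation.Unary.All.Properties as All
open import Data.List.Relation.Unary.Any as Any using (Any; here; there)
open import Data.List.Relation.Unary.Any.Properties using (lookup-index)
open import Data.Nat using (ℕ; zero; suc; _<_)
open import Data.Nat.Induction using (Acc; acc; <-wellFounded)
import Data.Nat.Properties as ℕ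
open import Data.Product using (∃; _×_; _,_; proj₁; proj₂)
open import Data.Sum using (_⊎_; inj₁; inj₂; [_,_]′)
open import Data.Unit using (⊤; tt)
open import Data.Vec using ([]; _∷_; lookup; tabulate)
open import Data.Vec.Properties using (lookup⇒[]=; []=⇒lookup; lookup∘tabulate; ≡-dec)
open import Effect.Monad using (RawMonad)
open import Function using (_∘_; id; const; _⇔_; mk⇔; Equivalence)
open import Level using (lift; lower)
open import Relation.Binary using (DecidableEquality; IsPartialEquivalence)
open import Relation.Binary.PropositionalEquality using (_≡_; refl; sym; trans; cong; cong₂; subst)
open import Relation.Nullary
  using (¬_; Dec; yes; no; does; proof; _because_; ¬?; _×-dec_; _→-dec_; contradiction)
open import Relation.Nullary.Decidable
  using (map′; decidable-stable; dec-true; recompute; ¬¬-excluded-middle)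
open import Relation.Nullary.Negation using (Stable; negated-stable; ¬¬-map; ¬¬-Monad)
open import Relation.Nullary.Reflects using (Reflects; invert; fromEquivalence)
open import Relation.Unary using (Decidable; U)
open import Relation.Unary.Properties using (U?)

private
  variable
    n       : ℕ
    s       : Variant
    φ ψ θ γ : Form n
    A       : Set

-- Propositional reasoning

Valuation : ℕ → Set
Valuation n = Form n → Bool

record _⊩_ (v : Valuation n) (φ : Form n) : Set where
  constructor holds
  field eval : evalB v φ ≡ true

open _⊩_

infix 4 _⊩_ _⊩?_

_⊩?_ : (v : Valuation n) (φ : Form n) → Dec (v ⊩ φ)
v ⊩? φ = map′ holds eval (evalB v φ Bool.≟ true)

⋀ : {P : A → Set} → Decidable P → (A → Form n) → List A → Form n
⋀ P? f = foldr (λ x φ → if does (P? x) then f x ∧ᶠ φ else φ) ⊤ᶠ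

⋁ : (A → Form n) → List A → Form n
⋁ f = foldr (λ x φ → f x ∨ᶠ φ) ⊥ᶠ

-- With membership decided by lookup, deadS X is ⋀ (_∈ᵛ? X) dead (allFin n) by definition.
_∈ᵛ?_ : (a : Fin n) (X : Subset n) → Dec (a ∈ˢ X)
a ∈ᵛ? X = lookup X a because
  fromEquivalence (lookup⇒[]= a X ∘ Equivalence.to Bool.T-≡)
                  (Equivalence.from Bool.T-≡ ∘ []=⇒lookup)

module _ {n} {v : Valuation n} where

  ¬-intro : ¬ v ⊩ φ → v ⊩ ¬ᶠ φ
  ¬-intro φ-fails = holds (cong not (Bool.¬-not (φ-fails ∘ holds)))

  ¬-elim : v ⊩ ¬ᶠ φ → ¬ v ⊩ φ
  ¬-elim (holds e) (holds e') = contradiction (trans (sym e) (cong not e')) λ ()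

  by-contradiction : ¬ v ⊩ ¬ᶠ φ → v ⊩ φ
  by-contradiction ¬¬φ = decidable-stable (v ⊩? _) (¬¬φ ∘ ¬-intro)

  ∧-intro : v ⊩ φ → v ⊩ ψ → v ⊩ φ ∧ᶠ ψ
  ∧-intro (holds e) (holds e') = holds (cong₂ _∧_ e e')

  ∧-elim : v ⊩ φ ∧ᶠ ψ → v ⊩ φ × v ⊩ ψ
  ∧-elim (holds e) = holds (Bool.∧-conicalˡ _ _ e) , holds (Bool.∧-conicalʳ _ _ e)

  ∨-introˡ : v ⊩ φ → v ⊩ φ ∨ᶠ ψ
  ∨-introˡ t = ¬-intro λ u → ¬-elim (proj₁ (∧-elim u)) t

  ∨-introʳ : v ⊩ ψ → v ⊩ φ ∨ᶠ ψ
  ∨-introʳ t = ¬-intro λ u → ¬-elim (proj₂ (∧-elim u)) t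

  ∨-elim : v ⊩ φ ∨ᶠ ψ → v ⊩ φ ⊎ v ⊩ ψ
  ∨-elim {φ = φ} t with v ⊩? φ
  ... | yes u = inj₁ u
  ... | no ¬u = inj₂ (by-contradiction λ ¬ψ → ¬-elim t (∧-intro (¬-intro ¬u) ¬ψ))

  ⇒-intro : (v ⊩ φ → v ⊩ ψ) → v ⊩ (φ ⇒ ψ)
  ⇒-intro f = ¬-intro λ t → ¬-elim (proj₂ (∧-elim t)) (f (proj₁ (∧-elim t)))

  ⇒-elim : v ⊩ (φ ⇒ ψ) → v ⊩ φ → v ⊩ ψ
  ⇒-elim t u = by-contradiction λ ¬ψ → ¬-elim t (∧-intro u ¬ψ)

  ⊥ᶠ-elim : ¬ v ⊩ ⊥ᶠ
  ⊥ᶠ-elim t = ¬-elim (proj₂ (∧-elim t)) (proj₁ (∧-elim t))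

  ⊤ᶠ-intro : v ⊩ ⊤ᶠ
  ⊤ᶠ-intro = ¬-intro ⊥ᶠ-elim

  ⋁-intro : {f : A → Form n} {xs : List A} → Any (λ x → v ⊩ f x) xs → v ⊩ ⋁ f xs
  ⋁-intro (here t)  = ∨-introˡ t
  ⋁-intro (there i) = ∨-introʳ (⋁-intro i)

  ⋁-elim : {f : A → Form n} (xs : List A) → v ⊩ ⋁ f xs → Any (λ x → v ⊩ f x) xs
  ⋁-elim []       t = contradiction t ⊥ᶠ-elim
  ⋁-elim (x ∷ xs) t with ∨-elim t
  ... | inj₁ u = here u
  ... | inj₂ u = there (⋁-elim xs u)

  module _ {P : A → Set} {P? : Decidable P} {f : A → Form n} where

    ⋀-intro : ∀ xs → (∀ {x} → x ∈ xs → P x → v ⊩ f x) → v ⊩ ⋀ P? f xs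
    ⋀-intro []       h = ⊤ᶠ-intro
    ⋀-intro (x ∷ xs) h with P? x
    ... | yes px = ∧-intro (h (here refl) px) (⋀-intro xs (h ∘ there))
    ... | no _   = ⋀-intro xs (h ∘ there)

    ⋀-elim : ∀ {xs} → v ⊩ ⋀ P? f xs → ∀ {x} → x ∈ xs → P x → v ⊩ f x
    ⋀-elim {x ∷ _} t (here refl) px with P? x
    ... | yes _  = proj₁ (∧-elim t)
    ... | no ¬px = contradiction px ¬px
    ⋀-elim {y ∷ _} t (there i) px with P? y
    ... | yes _ = ⋀-elim (proj₂ (∧-elim t)) i px
    ... | no _  = ⋀-elim t i px

  deadS-intro : ∀ X → (∀ {a} → a ∈ˢ X → v ⊩ dead a) → v ⊩ deadS X
  deadS-intro X h = ⋀-intro {P? = _∈ᵛ? X} (allFin n) λ _ → h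

  deadS-elim : ∀ X → v ⊩ deadS X → ∀ {a} → a ∈ˢ X → v ⊩ dead a
  deadS-elim X t = ⋀-elim {P? = _∈ᵛ? X} t (∈-allFin _)

consequence : ∀ {Θ} → All (s ⊢_) Θ → (∀ {v} → All (v ⊩_) Θ → v ⊩ φ) → s ⊢ φ
consequence []       h = taut λ _ → eval (h [])
consequence (p ∷ ps) h = mp (consequence ps λ ts → ⇒-intro λ t → h (t ∷ ts)) p

entailment : (∀ {v} → v ⊩ φ → v ⊩ ψ) → s ⊢ (φ ⇒ ψ)
entailment h = consequence [] λ _ → ⇒-intro h

⇒-trans : s ⊢ (φ ⇒ ψ) → s ⊢ (ψ ⇒ θ) → s ⊢ (φ ⇒ θ)
⇒-trans p q = consequence (p ∷ q ∷ []) λ { (t ∷ u ∷ []) → ⇒-intro (⇒-elim u ∘ ⇒-elim t) }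

contraposition : s ⊢ (φ ⇒ ψ) → s ⊢ (¬ᶠ ψ ⇒ ¬ᶠ φ)
contraposition p =
  consequence (p ∷ []) λ { (t ∷ []) → ⇒-intro λ ¬ψ → ¬-intro (¬-elim ¬ψ ∘ ⇒-elim t) }

¬¬-intro : s ⊢ (φ ⇒ ¬ᶠ ¬ᶠ φ)
¬¬-intro = entailment λ t → ¬-intro λ u → ¬-elim u t

⊥ᶠ-explosion : s ⊢ (⊥ᶠ ⇒ φ)
⊥ᶠ-explosion = entailment λ t → contradiction t ⊥ᶠ-elim

module _ {P : A → Set} {P? : Decidable P} where

  ⊢-⋀ : {f : A → Form n} → (∀ {x} → P x → s ⊢ f x) → ∀ xs → s ⊢ ⋀ P? f xs
  ⊢-⋀ p []       = consequence [] λ _ → ⊤ᶠ-intro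
  ⊢-⋀ p (x ∷ xs) with P? x
  ... | yes px = consequence (p px ∷ ⊢-⋀ p xs ∷ []) λ { (t ∷ u ∷ []) → ∧-intro t u }
  ... | no _   = ⊢-⋀ p xs

  ⇒-⋀ : {f : A → Form n} → (∀ {x} → P x → s ⊢ (γ ⇒ f x)) → ∀ xs → s ⊢ (γ ⇒ ⋀ P? f xs)
  ⇒-⋀ p xs = consequence (⊢-⋀ p xs ∷ []) λ { (t ∷ []) →
    ⇒-intro λ g → ⋀-intro {P? = P?} xs λ i px → ⇒-elim (⋀-elim {P? = P?} t i px) g }

-- Modal principles

module _ (B : Subset n) .(ne : Nonempty B) where

  D-map : s ⊢ (φ ⇒ ψ) → s ⊢ (D B ne φ ⇒ D B ne ψ)
  D-map p = mp (axK B ne _ _) (nec B ne p)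

  D-map₂ : s ⊢ (φ ⇒ ψ ⇒ θ) → s ⊢ (D B ne φ ⇒ D B ne ψ ⇒ D B ne θ)
  D-map₂ p = ⇒-trans (D-map p) (axK B ne _ _)

  ax5 : ∀ φ → s ⊢ (¬ᶠ D B ne φ ⇒ D B ne (¬ᶠ D B ne φ))
  ax5 φ = ⇒-trans (axB B ne _) (D-map (contraposition (⇒-trans (ax4 B ne φ) (D-map ¬¬-intro))))

  ¬D⇒aliveS : ∀ φ → s ⊢ (¬ᶠ D B ne φ ⇒ aliveS B ne)
  ¬D⇒aliveS φ = contraposition (D-map ⊥ᶠ-explosion)

  aliveS⇒D-reflexive : ∀ φ → s ⊢ (aliveS B ne ⇒ D B ne φ ⇒ φ)
  aliveS⇒D-reflexive φ = consequence (ax4 B ne φ ∷ axB B ne (¬ᶠ φ) ∷ D-map₂ clash ∷ [])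
    λ { (four ∷ b ∷ k ∷ []) → ⇒-intro λ alive → ⇒-intro λ d → by-contradiction λ ¬φ →
          ¬-elim alive (⇒-elim (⇒-elim k (⇒-elim four d)) (⇒-elim b ¬φ)) }
    where
    clash : s ⊢ (D B ne φ ⇒ ¬ᶠ D B ne (¬ᶠ ¬ᶠ φ) ⇒ ⊥ᶠ)
    clash = consequence (D-map ¬¬-intro ∷ [])
      λ { (t ∷ []) → ⇒-intro λ d → ⇒-intro λ ¬d → contradiction (⇒-elim t d) (¬-elim ¬d) }

  ⋀-persistent : {P : A → Set} {P? : Decidable P} {f : A → Form n} →
                 (∀ {x} → P x → s ⊢ (f x ⇒ D B ne (f x))) →
                 ∀ xs → s ⊢ (⋀ P? f xs ⇒ D B ne (⋀ P? f xs))
  ⋀-persistent p []       = consequence (nec B ne (consequence [] λ _ → ⊤ᶠ-intro) ∷ [])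
                              λ { (t ∷ []) → ⇒-intro λ _ → t }
  ⋀-persistent {P? = P?} p (x ∷ xs) with P? x
  ... | no _   = ⋀-persistent {P? = P?} p xs
  ... | yes px = consequence (p px ∷ ⋀-persistent {P? = P?} p xs ∷ D-map₂ pairing ∷ [])
      λ { (t ∷ u ∷ k ∷ []) → ⇒-intro λ h →
            ⇒-elim (⇒-elim k (⇒-elim t (proj₁ (∧-elim h)))) (⇒-elim u (proj₂ (∧-elim h))) }
    where
    pairing : s ⊢ (φ ⇒ ψ ⇒ φ ∧ᶠ ψ)
    pairing = entailment λ t → ⇒-intro (∧-intro t)

eachAlive : Subset n → Form n
eachAlive B = ⋀ (_∈ˢ? B) alive (allFin _)

⁅⁆⊆ : ∀ {a} {B : Subset n} → a ∈ˢ B → ⁅ a ⁆ ⊆ˢ B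
⁅⁆⊆ {B = B} a∈B x∈ = subst (_∈ˢ B) (sym (x∈⁅y⁆⇒x≡y _ x∈)) a∈B

aliveS-antitone : {B C : Subset n} .(ne : Nonempty B) .(ne' : Nonempty C) →
                  C ⊆ˢ B → s ⊢ (aliveS B ne ⇒ aliveS C ne')
aliveS-antitone {B = B} {C} ne ne' C⊆B = contraposition (axMono C B ne' ne ⊥ᶠ C⊆B)

module _ {n} {s : Variant} (B : Subset n) where

  aliveS⇒eachAlive : .(ne : Nonempty B) → s ⊢ (aliveS B ne ⇒ eachAlive B)
  aliveS⇒eachAlive ne = ⇒-⋀ {P? = _∈ˢ? B} (λ a∈B → aliveS-antitone ne _ (⁅⁆⊆ a∈B)) (allFin n)

  eachAlive⇒aliveS : (ne : Nonempty B) → s ⊢ (eachAlive B ⇒ aliveS B ne)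
  eachAlive⇒aliveS ne@(b , b∈B) = ⇒-trans
    (alive-span members (All.all-filter (_∈ˢ? B) (allFin n)))
    (aliveS-antitone (span-nonempty members) ne
      λ a∈B → ∈-span (∈-filter⁺ (_∈ˢ? B) (∈-allFin _) a∈B))
    where
    members : List (Fin n)
    members = filter (_∈ˢ? B) (allFin n)

    span : List (Fin n) → Subset n
    span = foldr (λ a C → ⁅ a ⁆ ∪ C) ⁅ b ⁆

    span-nonempty : ∀ as → Nonempty (span as)
    span-nonempty []       = b , x∈⁅x⁆ b
    span-nonempty (a ∷ as) = a , p⊆p∪q (span as) (x∈⁅x⁆ a)

    ∈-span : ∀ {a as} → a ∈ as → a ∈ˢ span as
    ∈-span {as = a ∷ as} (here refl) = p⊆p∪q (span as) (x∈⁅x⁆ a)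
    ∈-span {as = a ∷ as} (there i)   = q⊆p∪q ⁅ a ⁆ (span as) (∈-span i)

    alive-member : ∀ {a} → a ∈ˢ B → s ⊢ (eachAlive B ⇒ alive a)
    alive-member a∈B = entailment λ t → ⋀-elim {P? = _∈ˢ? B} t (∈-allFin _) a∈B

    alive-span : ∀ as → All (_∈ˢ B) as → s ⊢ (eachAlive B ⇒ aliveS (span as) (span-nonempty as))
    alive-span []       []           = alive-member b∈B
    alive-span (a ∷ as) (a∈B ∷ as⊆B) =
      consequence (alive-member a∈B ∷ alive-span as as⊆B ∷
                   axUnion ⁅ a ⁆ (span as) _ _ (span-nonempty (a ∷ as)) ∷ [])
        λ { (t ∷ u ∷ union ∷ []) → ⇒-intro λ h → ⇒-elim union (∧-intro (⇒-elim t h) (⇒-elim u h)) }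

faceAxiom : Variant → (B : Subset n) → .(Nonempty B) → Form n
faceAxiom min B ne = aliveS B ne ∧ᶠ deadS (∁ B) ⇒ D B ne (deadS (∁ B))
faceAxiom max B ne = aliveS B ne ⇒ ¬ᶠ D B ne (¬ᶠ deadS (∁ B))

deadS-∁-full : ∀ {v : Valuation n} B → ¬ Nonempty (∁ B) → v ⊩ deadS (∁ B)
deadS-∁-full B full = deadS-intro (∁ B) λ a∈ → contradiction (_ , a∈) full

⊢faceAxiom : ∀ s (B : Subset n) .(ne : Nonempty B) → s ⊢ faceAxiom s B ne
⊢faceAxiom min B ne with nonempty? (∁ B)
... | yes ne∁ = axMin refl B ne ne∁
... | no full = consequence (nec B ne (consequence [] λ _ → deadS-∁-full B full) ∷ [])
                  λ { (t ∷ []) → ⇒-intro λ _ → t }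
⊢faceAxiom max B ne with nonempty? (∁ B)
... | yes ne∁ = axMax refl B ne ne∁
... | no full = contraposition (D-map B ne
                  (entailment λ t → contradiction (deadS-∁-full B full) (¬-elim t)))

-- Prime formulas

primes : Form n → List (Form n)
primes (atom i)   = atom i ∷ []
primes (¬ᶠ φ)     = primes φ
primes (φ ∧ᶠ ψ)   = primes φ ++ primes ψ
primes (D B ne φ) = D B ne φ ∷ primes φ

primes-trans : ∀ (φ : Form n) {γ} → γ ∈ primes φ → primes γ ⊆ᴸ primes φ
primes-trans (atom i)   (here refl) j = j
primes-trans (¬ᶠ φ)     i           j = primes-trans φ i j
primes-trans (φ ∧ᶠ ψ)   i           j with ∈-++⁻ (primes φ) i
... | inj₁ i' = ∈-++⁺ˡ (primes-trans φ i' j)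
... | inj₂ i' = ∈-++⁺ʳ (primes φ) (primes-trans ψ i' j)
primes-trans (D B ne φ) (here refl) j = j
primes-trans (D B ne φ) (there i)   j = there (primes-trans φ i j)

evalB-prime : ∀ {v : Valuation n} φ {γ} → γ ∈ primes φ → evalB v γ ≡ v γ
evalB-prime (atom i)   (here refl) = refl
evalB-prime (¬ᶠ φ)     i           = evalB-prime φ i
evalB-prime (φ ∧ᶠ ψ)   i with ∈-++⁻ (primes φ) i
... | inj₁ i' = evalB-prime φ i'
... | inj₂ i' = evalB-prime ψ i'
evalB-prime (D B ne φ) (here refl) = refl
evalB-prime (D B ne φ) (there i)   = evalB-prime φ i

evalB-cong : ∀ {v w : Valuation n} φ → (∀ {γ} → γ ∈ primes φ → v γ ≡ w γ) → evalB v φ ≡ evalB w φ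
evalB-cong (atom i)   e = e (here refl)
evalB-cong (¬ᶠ φ)     e = cong not (evalB-cong φ e)
evalB-cong (φ ∧ᶠ ψ)   e =
  cong₂ _∧_ (evalB-cong φ (e ∘ ∈-++⁺ˡ)) (evalB-cong ψ (e ∘ ∈-++⁺ʳ (primes φ)))
evalB-cong (D B ne φ) e = e (here refl)

-- Sets of agents, sets of vertices and satisfaction

⊆⊎∃∉ : (B C : Subset n) → B ⊆ˢ C ⊎ ∃ λ a → a ∈ˢ B × a ∉ˢ C
⊆⊎∃∉ B C with any? (λ a → (a ∈ˢ? B) ×-dec ¬? (a ∈ˢ? C))
... | yes (a , a∈B , a∉C) = inj₂ (a , a∈B , a∉C)
... | no none = inj₁ λ a∈B → decidable-stable (_ ∈ˢ? C) λ a∉C → none (_ , a∈B , a∉C)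

module _ {P : Fin n → Set} (P? : Decidable P) where

  comprehension : Subset n
  comprehension = tabulate (does ∘ P?)

  ∈-comprehension : ∀ {a} → a ∈ˢ comprehension ⇔ P a
  ∈-comprehension {a} = mk⇔
    (λ a∈ → invert (subst (Reflects (P a)) (trans (sym does≡) ([]=⇒lookup a∈)) (proof (P? a))))
    (λ pa → lookup⇒[]= a comprehension (trans does≡ (dec-true (P? a) pa)))
    where
    does≡ : lookup comprehension a ≡ does (P? a)
    does≡ = lookup∘tabulate (does ∘ P?) a

module _ {V : Set} where

  ≐-refl : {X : Pred V} → X ≐ X
  ≐-refl = id , id

  ≐-sym : {X Y : Pred V} → X ≐ Y → Y ≐ X
  ≐-sym (X⊆Y , Y⊆X) = Y⊆X , X⊆Y

  ≐-trans : {X Y Z : Pred V} → X ≐ Y → Y ≐ Z → X ≐ Z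
  ≐-trans (X⊆Y , Y⊆X) (Y⊆Z , Z⊆Y) = (λ x → Y⊆Z (X⊆Y x)) , λ z → Y⊆X (Z⊆Y z)

module _ (M : Model n) (ℓ-stable : ∀ X i → Stable (ℓ M X i)) where

  ⊨-stable : ∀ ψ X → Stable (M , X ⊨ ψ)
  ⊨-stable (atom i)   X h = lift (ℓ-stable X i (¬¬-map lower h))
  ⊨-stable (¬ᶠ ψ)     X h = negated-stable h
  ⊨-stable (φ ∧ᶠ ψ)   X h = ⊨-stable φ X (¬¬-map proj₁ h) , ⊨-stable ψ X (¬¬-map proj₂ h)
  ⊨-stable (D B ne ψ) X h Y wY B⊆ = ⊨-stable ψ Y (¬¬-map (λ d → d Y wY B⊆) h)

-- Frames

-- R B is not assumed to be the intersection of the R ⁅ a ⁆ for a ∈ B, which only holds after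
-- unravelling.
record Frame (n : ℕ) : Set₁ where
  field
    World                  : Set
    live                   : World → Subset n
    live-nonempty          : ∀ w → Nonempty (live w)
    R                      : Subset n → World → World → Set
    R-isPartialEquivalence : ∀ B → IsPartialEquivalence (R B)
    R-dom                  : ∀ {B w w'} → R B w w' → B ⊆ˢ live w
    R-refl                 : ∀ {B w} → B ⊆ˢ live w → R B w w
    R-mono                 : ∀ {B C w w'} → C ⊆ˢ B → R B w w' → R C w w'

  module _ {B : Subset n} where
    open IsPartialEquivalence (R-isPartialEquivalence B) public
      renaming (sym to R-sym; trans to R-trans)

  R-cod : ∀ {B w w'} → R B w w' → B ⊆ˢ live w'
  R-cod r = R-dom (R-sym r)

FrameCondition : Variant → Frame n → Set
FrameCondition min F = ∀ w w' → R (live w) w w' → live w' ⊆ˢ live w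
  where open Frame F
FrameCondition max F = ∀ B w → Nonempty B → B ⊆ˢ live w → ∃ λ w' → R B w w' × live w' ⊆ˢ B
  where open Frame F

record Interpretation (F : Frame n) (Δ : List (Form n)) : Set where
  open Frame F
  field
    val     : World → Valuation n
    box     : ∀ {B} .{ne : Nonempty B} {ψ w w'} → D B ne ψ ∈ Δ → R B w w' →
              val w ⊩ D B ne ψ → val w' ⊩ ψ
    diamond : ∀ {B} .{ne : Nonempty B} {ψ w} → D B ne ψ ∈ Δ →
              val w ⊩ ¬ᶠ D B ne ψ → ∃ λ w' → R B w w' × val w' ⊩ ¬ᶠ ψ
    exact   : ∀ {i w w'} → atom i ∈ Δ → R (live w) w w' → live w' ⊆ˢ live w →
              val w ⊩ atom i → val w' ⊩ atom i

module Unravelling (F : Frame n) (w₀ : Frame.World F) where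

  open Frame F

  data Path : Set
  last : Path → World

  data Path where
    root : Path
    step : (p : Path) (B : Subset n) (w : World) → R B (last p) w → Path

  last root           = w₀
  last (step _ _ w _) = w

  Live : Path → Subset n
  Live p = live (last p)

  -- p and step p B w r share their a-coloured vertex exactly when a ∈ B, so this
  -- vertex is represented by the earliest prefix reached along edges containing a.
  rep : Fin n → Path → Path
  rep a root = root
  rep a (step p B w r) with a ∈ˢ? B
  ... | yes _ = rep a p
  ... | no  _ = step p B w r

  IsRep : Fin n → Path → Set
  IsRep a root           = ⊤
  IsRep a (step p B w r) = a ∉ˢ B

  isRep? : ∀ a p → Dec (IsRep a p)
  isRep? a root           = yes tt
  isRep? a (step p B w r) = ¬? (a ∈ˢ? B)

  rep-∈ : ∀ {a} p {B w r} → a ∈ˢ B → rep a (step p B w r) ≡ rep a p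
  rep-∈ {a} p {B} a∈B with a ∈ˢ? B
  ... | yes _  = refl
  ... | no a∉B = contradiction a∈B a∉B

  rep-fixed : ∀ {a} p → IsRep a p → rep a p ≡ p
  rep-fixed root _ = refl
  rep-fixed {a} (step p B w r) a∉B with a ∈ˢ? B
  ... | yes a∈B = contradiction a∈B a∉B
  ... | no _    = refl

  rep-isRep : ∀ a p → IsRep a (rep a p)
  rep-isRep a root = tt
  rep-isRep a (step p B w r) with a ∈ˢ? B
  ... | yes _  = rep-isRep a p
  ... | no a∉B = a∉B

  rep-live : ∀ {a} p → a ∈ˢ Live p → a ∈ˢ Live (rep a p)
  rep-live root a∈ = a∈
  rep-live {a} (step p B w r) a∈ with a ∈ˢ? B
  ... | yes a∈B = rep-live p (R-dom r a∈B)
  ... | no _    = a∈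

  depth : Path → ℕ
  depth root           = 0
  depth (step p _ _ _) = suc (depth p)

  rep≡⊎shallower : ∀ a p → rep a p ≡ p ⊎ depth (rep a p) < depth p
  rep≡⊎shallower a root = inj₁ refl
  rep≡⊎shallower a (step p B w r) with a ∈ˢ? B
  ... | no _  = inj₁ refl
  ... | yes _ with rep≡⊎shallower a p
  ...   | inj₁ e  = inj₂ (ℕ.≤-reflexive (cong (suc ∘ depth) e))
  ...   | inj₂ lt = inj₂ (ℕ.m<n⇒m<1+n lt)

  rep-antisym : ∀ {a b} p q → p ≡ rep a q → q ≡ rep b p → p ≡ q
  rep-antisym {a} {b} p q p≡ q≡ with rep≡⊎shallower a q | rep≡⊎shallower b p
  ... | inj₁ e   | _        = trans p≡ e
  ... | inj₂ _   | inj₁ e   = sym (trans q≡ e)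
  ... | inj₂ p<q | inj₂ q<p = contradiction (subst (λ x → depth x < depth p) (sym q≡) q<p)
                                            (ℕ.<-asym (subst (λ x → depth x < depth q) (sym p≡) p<q))

  record Anchor (B : Subset n) (p : Path) : Set where
    field
      anchor      : Path
      agent       : Fin n
      agent∈      : agent ∈ˢ B
      isRep       : IsRep agent anchor
      anchor-R    : R B (last anchor) (last p)
      anchor-reps : ∀ {a} → a ∈ˢ B → rep a anchor ≡ rep a p

  -- Go back along the edges containing B, up to the root or to an edge missing some agent of B.
  anchored : ∀ {B} → Nonempty B → ∀ p → B ⊆ˢ Live p → Anchor B p
  anchored (b , b∈B) root B⊆p = record
    { anchor = root ; agent = b ; agent∈ = b∈B ; isRep = tt ; anchor-R = R-refl B⊆p
    ; anchor-reps = λ _ → refl }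
  anchored {B} ne (step p C w r) B⊆p with ⊆⊎∃∉ B C
  ... | inj₂ (a , a∈B , a∉C) = record
    { anchor = step p C w r ; agent = a ; agent∈ = a∈B ; isRep = a∉C ; anchor-R = R-refl B⊆p
    ; anchor-reps = λ _ → refl }
  ... | inj₁ B⊆C = record
    { Anchor back
    ; anchor-R    = R-trans (Anchor.anchor-R back) (R-mono B⊆C r)
    ; anchor-reps = λ a∈B → trans (Anchor.anchor-reps back a∈B) (sym (rep-∈ p (B⊆C a∈B)))
    }
    where
    back : Anchor B p
    back = anchored ne p (R-dom r ∘ B⊆C)

  reps-shared⇒R : ∀ {B} → Nonempty B → ∀ p q → B ⊆ˢ Live p → B ⊆ˢ Live q →
                  (∀ {a} → a ∈ˢ B → rep a p ≡ rep a q) → R B (last p) (last q)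
  reps-shared⇒R {B} ne p q B⊆p B⊆q shared =
    R-trans (R-sym P.anchor-R) (subst (λ x → R B (last x) (last q)) (sym anchors-≡) Q.anchor-R)
    where
    module P = Anchor (anchored ne p B⊆p)
    module Q = Anchor (anchored ne q B⊆q)

    anchors-share : ∀ {a} → a ∈ˢ B → rep a P.anchor ≡ rep a Q.anchor
    anchors-share a∈B = trans (P.anchor-reps a∈B) (trans (shared a∈B) (sym (Q.anchor-reps a∈B)))

    anchors-≡ : P.anchor ≡ Q.anchor
    anchors-≡ = rep-antisym P.anchor Q.anchor
      (trans (sym (rep-fixed P.anchor P.isRep)) (anchors-share P.agent∈))
      (trans (sym (rep-fixed Q.anchor Q.isRep)) (sym (anchors-share Q.agent∈)))

  record Vertex : Set where
    constructor vertex
    field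
      colour  : Fin n
      pos     : Path
      .posRep : IsRep colour pos
      .isLive : colour ∈ˢ Live pos

  open Vertex

  vertex-≡ : ∀ {u v} → colour u ≡ colour v → pos u ≡ pos v → u ≡ v
  vertex-≡ refl refl = refl

  record verts (p : Path) (v : Vertex) : Set where
    constructor _,_
    field
      alive-at : colour v ∈ˢ Live p
      rep≡pos  : rep (colour v) p ≡ pos v

  open verts

  vertexAt : ∀ p {a} → a ∈ˢ Live p → Vertex
  vertexAt p {a} a∈ = vertex a (rep a p) (rep-isRep a p) (rep-live p a∈)

  vertexAt-∈ : ∀ p {a} (a∈ : a ∈ˢ Live p) → verts p (vertexAt p a∈)
  vertexAt-∈ p a∈ = a∈ , refl

  vertex-∈ : ∀ v → verts (pos v) v
  vertex-∈ (vertex a p posRep isLive) =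
    recompute (a ∈ˢ? Live p) isLive , rep-fixed p (recompute (isRep? a p) posRep)

  verts-chromatic : ∀ p {u v} → verts p u → verts p v → colour u ≡ colour v → u ≡ v
  verts-chromatic p (_ , eu) (_ , ev) c =
    vertex-≡ c (trans (sym eu) (trans (cong (λ a → rep a p) c) ev))

  verts-nonempty : ∀ p → NonEmptyP (verts p)
  verts-nonempty p with live-nonempty (last p)
  ... | _ , a∈ = vertexAt p a∈ , vertexAt-∈ p a∈

  Simplex : Pred Vertex → Set
  Simplex X = NonEmptyP X × ∃ λ p → X ⊆ verts p

  IsPath : Pred Vertex → Set
  IsPath X = ∃ λ p → X ≐ verts p

  verts-simplex : ∀ p → Simplex (verts p)
  verts-simplex p = verts-nonempty p , p , id

  IsPath⇒Simplex : ∀ {X} → IsPath X → Simplex X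
  IsPath⇒Simplex (p , X⊆p , p⊆X) = (_ , p⊆X (proj₂ (verts-nonempty p))) , p , X⊆p

  verts-⊆⇒Live-⊆ : ∀ p q → verts p ⊆ verts q → Live p ⊆ˢ Live q
  verts-⊆⇒Live-⊆ p q p⊆q a∈ = alive-at (p⊆q (vertexAt-∈ p a∈))

  verts-⊆⇒R : ∀ p q → verts p ⊆ verts q → R (Live p) (last p) (last q)
  verts-⊆⇒R p q p⊆q = reps-shared⇒R (live-nonempty (last p)) p q id (verts-⊆⇒Live-⊆ p q p⊆q)
                        λ a∈ → sym (rep≡pos (p⊆q (vertexAt-∈ p a∈)))

  verts-⊆-sym : FrameCondition min F → ∀ p q → verts p ⊆ verts q → verts q ⊆ verts p
  verts-⊆-sym F-min p q p⊆q v∈q = subst (verts p) (verts-chromatic q (p⊆q u∈p) v∈q refl) u∈p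
    where
    u∈p : verts p _
    u∈p = vertexAt-∈ p (F-min _ _ (verts-⊆⇒R p q p⊆q) (alive-at v∈q))

  Coloured : Pred Vertex → Fin n → Set
  Coloured X a = ∃ λ v → X v × colour v ≡ a

  decidable-simplex⇒IsPath : FrameCondition max F → ∀ {X} → Simplex X →
                             (∀ a → Dec (Coloured X a)) → IsPath X
  decidable-simplex⇒IsPath F-max {X} ((x , xX) , p , X⊆p) coloured? =
    extend (F-max B (last p) (colour x , ∈B xX) B⊆p)
    where
    B : Subset n
    B = comprehension coloured?

    ∈B : ∀ {v} → X v → colour v ∈ˢ B
    ∈B xv = Equivalence.from (∈-comprehension coloured?) (_ , xv , refl)

    B⊆p : B ⊆ˢ Live p
    B⊆p a∈B with Equivalence.to (∈-comprehension coloured?) a∈B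
    ... | v , xv , refl = alive-at (X⊆p xv)

    extend : (∃ λ w → R B (last p) w × live w ⊆ˢ B) → IsPath X
    extend (w , r , w⊆B) = q , X⊆q , q⊆X
      where
      q : Path
      q = step p B w r

      X⊆q : X ⊆ verts q
      X⊆q xv = R-cod r (∈B xv) , trans (rep-∈ p (∈B xv)) (rep≡pos (X⊆p xv))

      q⊆X : verts q ⊆ X
      q⊆X v∈q with Equivalence.to (∈-comprehension coloured?) (w⊆B (alive-at v∈q))
      ... | u , xu , c = subst X (verts-chromatic q (X⊆q xu) v∈q c) xu

  Simplex⇒¬¬IsPath : FrameCondition max F → ∀ {X} → Simplex X → ¬ ¬ IsPath X
  Simplex⇒¬¬IsPath F-max X-simplex =
    ¬¬-map (decidable-simplex⇒IsPath F-max X-simplex)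
           (sequence (RawMonad.rawApplicative ¬¬-Monad) λ _ → ¬¬-excluded-middle)

  record Worlds : Set₁ where
    field
      IsWorld          : Pred Vertex → Set
      IsWorld-resp     : ∀ X Y → X ≐ Y → IsWorld X → IsWorld Y
      IsWorld⇒Simplex  : ∀ X → IsWorld X → Simplex X
      IsWorld⇒¬¬IsPath : ∀ {X} → IsWorld X → ¬ ¬ IsPath X
      verts-IsWorld    : ∀ p → IsWorld (verts p)

  pathWorlds : Worlds
  pathWorlds = record
    { IsWorld          = IsPath
    ; IsWorld-resp     = λ X Y X≐Y → λ { (p , X≐p) → p , ≐-trans (≐-sym X≐Y) X≐p }
    ; IsWorld⇒Simplex  = λ _ → IsPath⇒Simplex
    ; IsWorld⇒¬¬IsPath = contradiction
    ; verts-IsWorld    = λ p → p , ≐-refl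
    }

  simplexWorlds : FrameCondition max F → Worlds
  simplexWorlds F-max = record
    { IsWorld          = Simplex
    ; IsWorld-resp     = λ { X Y (X⊆Y , Y⊆X) ((_ , x) , p , X⊆p) → (_ , X⊆Y x) , p , λ y → X⊆p (Y⊆X y) }
    ; IsWorld⇒Simplex  = λ _ → id
    ; IsWorld⇒¬¬IsPath = Simplex⇒¬¬IsPath F-max
    ; verts-IsWorld    = verts-simplex
    }

  module _ {Δ : List (Form n)} (I : Interpretation F Δ) (𝒲 : Worlds) where

    open Interpretation I
    open Worlds 𝒲

    -- The double negation in ℓ makes satisfaction ¬¬-stable, which is needed because a simplex
    -- with an undecidable set of colours is only ¬¬-equal to some verts p.
    model : Model n
    model = record
      { V           = Vertex
      ; χ           = colour
      ; S           = Simplex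
      ; S-nonempty  = λ _ → proj₁
      ; S-singleton = λ v → (v , refl) , pos v , λ { refl → vertex-∈ v }
      ; S-down      = λ { X Y (_ , p , X⊆p) Y⊆X ne → ne , p , λ y → X⊆p (Y⊆X y) }
      ; chromatic   = λ { X (_ , p , X⊆p) u v xu xv → verts-chromatic p (X⊆p xu) (X⊆p xv) }
      ; W           = IsWorld
      ; W-resp      = IsWorld-resp
      ; facet⊆W     = λ { X ((_ , p , X⊆p) , X-max) →
                          IsWorld-resp _ _ (X-max _ (verts-simplex p) X⊆p , X⊆p) (verts-IsWorld p) }
      ; W⊆S         = IsWorld⇒Simplex
      ; ℓ           = λ X i → ¬ ¬ ∃ λ p → X ≐ verts p × val (last p) ⊩ atom i
      ; ℓ-resp      = λ X Y i X≐Y → ¬¬-map λ { (p , X≐p , t) → p , ≐-trans (≐-sym X≐Y) X≐p , t }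
      }

    ⊆χ∩⇒R : ∀ {B X Y} → Nonempty B → ∀ p q → X ⊆ verts p → Y ⊆ verts q →
            _⊆χ_∩_ {M = model} B X Y → R B (last p) (last q)
    ⊆χ∩⇒R {B} ne p q X⊆p Y⊆q common = reps-shared⇒R ne p q B⊆p B⊆q shared
      where
      B⊆p : B ⊆ˢ Live p
      B⊆p a∈B with common _ a∈B
      ... | v , x , y , refl = alive-at (X⊆p x)

      B⊆q : B ⊆ˢ Live q
      B⊆q a∈B with common _ a∈B
      ... | v , x , y , refl = alive-at (Y⊆q y)

      shared : ∀ {a} → a ∈ˢ B → rep a p ≡ rep a q
      shared a∈B with common _ a∈B
      ... | v , x , y , refl = trans (rep≡pos (X⊆p x)) (sym (rep≡pos (Y⊆q y)))

    step-⊆χ∩ : ∀ {B X} p w r → verts p ⊆ X → _⊆χ_∩_ {M = model} B X (verts (step p B w r))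
    step-⊆χ∩ p w r p⊆X a a∈B =
      vertexAt p a∈p , p⊆X (vertexAt-∈ p a∈p) , (R-cod r a∈B , rep-∈ p a∈B) , refl
      where
      a∈p : a ∈ˢ Live p
      a∈p = R-dom r a∈B

    truth : ∀ ψ → primes ψ ⊆ᴸ Δ → ∀ p {X} → X ≐ verts p → val (last p) ⊩ ψ ⇔ (model , X ⊨ ψ)
    truth (atom i) ψ⊆Δ p {X} X≐p = mk⇔ (λ t → lift (contradiction (p , X≐p , t))) from
      where
      from : model , X ⊨ atom i → val (last p) ⊩ atom i
      from (lift h) = decidable-stable (_ ⊩? _) (¬¬-map (λ { (q , X≐q , t) →
        let p⊆q , q⊆p = ≐-trans (≐-sym X≐p) X≐q
        in exact (ψ⊆Δ (here refl)) (verts-⊆⇒R q p q⊆p) (verts-⊆⇒Live-⊆ p q p⊆q) t }) h)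
    truth (¬ᶠ ψ) ψ⊆Δ p X≐p = mk⇔ (λ t → ¬-elim t ∘ from) (λ h → ¬-intro (h ∘ to))
      where open Equivalence (truth ψ ψ⊆Δ p X≐p)
    truth (φ ∧ᶠ ψ) ψ⊆Δ p X≐p = mk⇔
      (λ t → Φ.to (proj₁ (∧-elim t)) , Ψ.to (proj₂ (∧-elim t)))
      (λ { (hφ , hψ) → ∧-intro (Φ.from hφ) (Ψ.from hψ) })
      where
      module Φ = Equivalence (truth φ (ψ⊆Δ ∘ ∈-++⁺ˡ) p X≐p)
      module Ψ = Equivalence (truth ψ (ψ⊆Δ ∘ ∈-++⁺ʳ (primes φ)) p X≐p)
    truth (D B ne ψ) ψ⊆Δ p {X} X≐p@(X⊆p , p⊆X) = mk⇔ to from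
      where
      to : val (last p) ⊩ D B ne ψ → model , X ⊨ D B ne ψ
      to t Y wY B⊆ = ⊨-stable model (λ _ _ → negated-stable) ψ Y (¬¬-map (λ { (q , Y≐q) →
        Equivalence.to (truth ψ (ψ⊆Δ ∘ there) q Y≐q)
          (box (ψ⊆Δ (here refl)) (⊆χ∩⇒R (recompute (nonempty? B) ne) p q X⊆p (proj₁ Y≐q) B⊆) t) })
        (IsWorld⇒¬¬IsPath wY))

      from : model , X ⊨ D B ne ψ → val (last p) ⊩ D B ne ψ
      from h = by-contradiction λ ¬d →
        let w , r , ¬ψ = diamond (ψ⊆Δ (here refl)) ¬d
            q          = step p B w r
        in ¬-elim ¬ψ (Equivalence.from (truth ψ (ψ⊆Δ ∘ there) q ≐-refl)
                       (h (verts q) (verts-IsWorld q) (step-⊆χ∩ p w r p⊆X)))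

    valid⇒⊩-at-root : primes φ ⊆ᴸ Δ → (∀ X → IsWorld X → model , X ⊨ φ) → val w₀ ⊩ φ
    valid⇒⊩-at-root φ⊆Δ valid =
      Equivalence.from (truth _ φ⊆Δ root ≐-refl) (valid (verts root) (verts-IsWorld root))

  pathWorlds-minimal : FrameCondition min F → ∀ {Δ} (I : Interpretation F Δ) →
                       IsMinimal (model I pathWorlds)
  pathWorlds-minimal F-min I X X-path@(p , X⊆p , p⊆X) =
    IsPath⇒Simplex X-path , λ { Y (_ , q , Y⊆q) X⊆Y y →
      p⊆X (verts-⊆-sym F-min p q (λ u → Y⊆q (X⊆Y (p⊆X u))) (Y⊆q y)) }

Valid : Variant → Form n → Set₁
Valid min = ValidMin
Valid max = ValidMax

Valid⇒⊩ : ∀ s {F : Frame n} {Δ} → FrameCondition s F → (I : Interpretation F Δ) →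
          primes φ ⊆ᴸ Δ → Valid s φ → ∀ w → Interpretation.val I w ⊩ φ
Valid⇒⊩ min {F} F-min I φ⊆Δ valid w =
  valid⇒⊩-at-root I pathWorlds φ⊆Δ (valid (model I pathWorlds) (pathWorlds-minimal F-min I))
  where open Unravelling F w
Valid⇒⊩ max {F} F-max I φ⊆Δ valid w =
  valid⇒⊩-at-root I (simplexWorlds F-max) φ⊆Δ (valid (model I (simplexWorlds F-max)) λ _ → id)
  where open Unravelling F w

-- Enumerations

_≟ᶠ_ : DecidableEquality (Form n)
atom i     ≟ᶠ atom j     = map′ (cong atom) (λ { refl → refl }) (i ℕ.≟ j)
(¬ᶠ φ)     ≟ᶠ (¬ᶠ ψ)     = map′ (cong ¬ᶠ_) (λ { refl → refl }) (φ ≟ᶠ ψ)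
(φ ∧ᶠ φ')  ≟ᶠ (ψ ∧ᶠ ψ')  =
  map′ (λ { (refl , refl) → refl }) (λ { refl → refl , refl }) (φ ≟ᶠ ψ ×-dec φ' ≟ᶠ ψ')
D B _ φ    ≟ᶠ D C _ ψ    =
  map′ (λ { (refl , refl) → refl }) (λ { refl → refl , refl }) (≡-dec Bool._≟_ B C ×-dec φ ≟ᶠ ψ)
atom _     ≟ᶠ (¬ᶠ _)     = no λ ()
atom _     ≟ᶠ (_ ∧ᶠ _)   = no λ ()
atom _     ≟ᶠ D _ _ _    = no λ ()
(¬ᶠ _)     ≟ᶠ atom _     = no λ ()
(¬ᶠ _)     ≟ᶠ (_ ∧ᶠ _)   = no λ ()
(¬ᶠ _)     ≟ᶠ D _ _ _    = no λ ()
(_ ∧ᶠ _)   ≟ᶠ atom _     = no λ ()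
(_ ∧ᶠ _)   ≟ᶠ (¬ᶠ _)     = no λ ()
(_ ∧ᶠ _)   ≟ᶠ D _ _ _    = no λ ()
D _ _ _    ≟ᶠ atom _     = no λ ()
D _ _ _    ≟ᶠ (¬ᶠ _)     = no λ ()
D _ _ _    ≟ᶠ (_ ∧ᶠ _)   = no λ ()

subsets : ∀ n → List (Subset n)
subsets zero    = [] ∷ []
subsets (suc n) = cartesianProductWith _∷_ (inside ∷ outside ∷ []) (subsets n)

∈-subsets : (B : Subset n) → B ∈ subsets n
∈-subsets []              = here refl
∈-subsets {suc n} (b ∷ B) =
  ∈-cartesianProductWith⁺ _∷_ {inside ∷ outside ∷ []} {subsets n} (b∈ b) (∈-subsets B)
  where
  b∈ : ∀ b → b ∈ inside ∷ outside ∷ []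
  b∈ inside  = here refl
  b∈ outside = there (here refl)

module _ {n} {A : Set} (f : (B : Subset n) → .(Nonempty B) → List A) where

  onNonempty : Subset n → List A
  onNonempty B with nonempty? B
  ... | yes ne = f B ne
  ... | no _   = []

  concatNonempty : List A
  concatNonempty = concatMap onNonempty (subsets n)

  ∈-concatNonempty⁺ : ∀ {B x} (ne : Nonempty B) → x ∈ f B ne → x ∈ concatNonempty
  ∈-concatNonempty⁺ {B} {x} ne x∈ = ∈-concatMap⁺ onNonempty (lose (∈-subsets B) x∈B)
    where
    x∈B : x ∈ onNonempty B
    x∈B with nonempty? B
    ... | yes _   = x∈
    ... | no ¬ne = contradiction ne ¬ne

  All-concatNonempty⁺ : {P : A → Set} → (∀ B .(ne : Nonempty B) → All P (f B ne)) →
                        All P concatNonempty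
  All-concatNonempty⁺ {P} h = All.concat⁺ (All.map⁺ {xs = subsets n} (All.tabulate λ {B} _ → atB B))
    where
    atB : ∀ B → All P (onNonempty B)
    atB B with nonempty? B
    ... | yes ne = h B ne
    ... | no _   = []

module _ {n} (Γ : List (Form n)) where

  open import Data.List.Membership.DecPropositional (_≟ᶠ_ {n}) using (_∈?_)

  valuationOn : Subset (length Γ) → Valuation n
  valuationOn X γ with γ ∈? Γ
  ... | yes i = lookup X (Any.index i)
  ... | no _  = false

  valuations : List (Valuation n)
  valuations = map valuationOn (subsets (length Γ))

  valuations-complete : ∀ v → Any (λ w → ∀ {γ} → γ ∈ Γ → v γ ≡ w γ) valuations
  valuations-complete v = lose (∈-map⁺ valuationOn (∈-subsets X)) agree
    where
    X : Subset (length Γ)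
    X = tabulate (v ∘ List.lookup Γ)

    agree : ∀ {γ} → γ ∈ Γ → v γ ≡ valuationOn X γ
    agree {γ} γ∈ with γ ∈? Γ
    ... | yes i = trans (cong v (lookup-index i))
                        (sym (lookup∘tabulate (v ∘ List.lookup Γ) (Any.index i)))
    ... | no γ∉ = contradiction γ∈ γ∉

-- Elimination of types

module _ {Keep : List A → A → Set} (keep? : ∀ xs → Decidable (Keep xs)) {Inv : List A → Set}
         (Inv-filter : ∀ {xs} → Inv xs → Inv (filter (keep? xs) xs)) where

  stabilise : ∀ {xs} → Inv xs → ∃ λ ys → Inv ys × All (Keep ys) ys
  stabilise {xs} = go xs (<-wellFounded _)
    where
    go : ∀ xs → Acc _<_ (length xs) → Inv xs → ∃ λ ys → Inv ys × All (Keep ys) ys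
    go xs (acc rec) inv with All.all? (keep? xs) xs
    ... | yes all-kept = xs , inv , all-kept
    ... | no ¬all-kept = go (filter (keep? xs) xs)
                            (rec (filter-notAll (keep? xs) xs (All.¬All⇒Any¬ (keep? xs) xs ¬all-kept)))
                            (Inv-filter inv)

⊢⋁-filter : {P : A → Set} (P? : Decidable P) {f : A → Form n} (xs : List A) →
            (∀ {x} → ¬ P x → s ⊢ (¬ᶠ f x)) → s ⊢ ⋁ f xs → s ⊢ ⋁ f (filter P? xs)
⊢⋁-filter P? {f} xs refuted p =
  consequence (p ∷ ⊢-⋀ {P? = ¬? ∘ P?} refuted xs ∷ []) λ { (t ∷ u ∷ []) →
    let x , x∈ , fx = find (⋁-elim xs t)
        px = decidable-stable (P? x) λ ¬px → ¬-elim (⋀-elim {P? = ¬? ∘ P?} u x∈ ¬px) fx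
    in ⋁-intro (lose (∈-filter⁺ P? x∈ px) fx) }

data Boxed {n} (B : Subset n) : Form n → Set where
  boxed : ∀ {C ψ} .{ne : Nonempty C} → C ⊆ˢ B → Boxed B (D C ne ψ)

boxed? : (B : Subset n) → Decidable (Boxed B)
boxed? B (atom _)   = no λ ()
boxed? B (¬ᶠ _)     = no λ ()
boxed? B (_ ∧ᶠ _)   = no λ ()
boxed? B (D C _ _)  = map′ boxed (λ { (boxed C⊆B) → C⊆B }) (C ⊆ˢ? B)

Boxed-mono : {B C : Subset n} → C ⊆ˢ B → Boxed C φ → Boxed B φ
Boxed-mono C⊆B (boxed E⊆C) = boxed (C⊆B ∘ E⊆C)

literal : Valuation n → Form n → Form n
literal w γ = if w γ then γ else ¬ᶠ γ

⊩-literal : ∀ {v} (w : Valuation n) γ → evalB v γ ≡ v γ → v ⊩ literal w γ ⇔ v γ ≡ w γ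
⊩-literal w γ v-prime with w γ
... | true  = mk⇔ (λ t → trans (sym v-prime) (eval t)) (λ e → holds (trans v-prime e))
... | false = mk⇔ (λ t → trans (sym v-prime) (Bool.not-injective (eval t)))
                  (λ e → holds (cong not (trans v-prime e)))

literal-persistent : ∀ (w : Valuation n) (B : Subset n) .(ne : Nonempty B) {γ} → Boxed B γ →
                     s ⊢ (literal w γ ⇒ D B ne (literal w γ))
literal-persistent w B ne {D C neC ψ} (boxed C⊆B) with w (D C neC ψ)
... | true  = ⇒-trans (ax4 C neC ψ) (axMono C B neC ne _ C⊆B)
... | false = ⇒-trans (ax5 C neC ψ) (axMono C B neC ne _ C⊆B)

module TypeElimination {n : ℕ} (s : Variant) (Δ : List (Form n)) where

  Γ : List (Form n)
  Γ = concatMap primes Δ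

  Δ-primes : ∀ {φ} → φ ∈ Δ → primes φ ⊆ᴸ Γ
  Δ-primes φ∈ γ∈ = ∈-concatMap⁺ primes (lose φ∈ γ∈)

  Γ-closed : ∀ {γ} → γ ∈ Γ → primes γ ⊆ᴸ Γ
  Γ-closed γ∈ δ∈ with find (∈-concatMap⁻ primes {xs = Δ} γ∈)
  ... | φ , φ∈ , γ∈φ = Δ-primes φ∈ (primes-trans φ γ∈φ δ∈)

  evalB-Γ : ∀ {v γ} → γ ∈ Γ → evalB v γ ≡ v γ
  evalB-Γ γ∈ with find (∈-concatMap⁻ primes {xs = Δ} γ∈)
  ... | φ , _ , γ∈φ = evalB-prime φ γ∈φ

  infix 4 _≈[_]_ _≈[_]?_

  _≈[_]_ : Valuation n → (Form n → Set) → Valuation n → Set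
  v ≈[ P ] w = All (λ γ → P γ → v γ ≡ w γ) Γ

  _≈[_]?_ : ∀ v {P : Form n → Set} → Decidable P → ∀ w → Dec (v ≈[ P ] w)
  v ≈[ P? ]? w = All.all? (λ γ → P? γ →-dec (v γ Bool.≟ w γ)) Γ

  ⊩-resp-≈ : ∀ {v w φ} → primes φ ⊆ᴸ Γ → v ≈[ U ] w → v ⊩ φ ⇔ w ⊩ φ
  ⊩-resp-≈ {v} {w} {φ} φ⊆Γ v≈w =
    mk⇔ (λ { (holds t) → holds (trans (sym same) t) }) (λ { (holds t) → holds (trans same t) })
    where
    same : evalB v φ ≡ evalB w φ
    same = evalB-cong φ λ γ∈ → All.lookup v≈w (φ⊆Γ γ∈) tt

  ⊩D-resp-≈ : ∀ {B C v w ψ} .{ne : Nonempty C} → D C ne ψ ∈ Γ → C ⊆ˢ B → v ≈[ Boxed B ] w →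
              v ⊩ D C ne ψ ⇔ w ⊩ D C ne ψ
  ⊩D-resp-≈ {C = C} {v} {w} {ψ} {ne} d∈ C⊆B v≈w =
    mk⇔ (λ { (holds t) → holds (trans (sym same) t) }) (λ { (holds t) → holds (trans same t) })
    where
    same : v (D C ne ψ) ≡ w (D C ne ψ)
    same = All.lookup v≈w d∈ (boxed C⊆B)

  literals : {P : Form n → Set} → Decidable P → Valuation n → Form n
  literals P? w = ⋀ P? (literal w) Γ

  ⊩-literals : ∀ {P : Form n → Set} (P? : Decidable P) {v w} → v ⊩ literals P? w ⇔ v ≈[ P ] w
  ⊩-literals P? {v} {w} = mk⇔
    (λ t → All.tabulate λ γ∈ p → Equivalence.to (at γ∈) (⋀-elim {P? = P?} t γ∈ p))
    (λ v≈w → ⋀-intro {P? = P?} Γ λ γ∈ p → Equivalence.from (at γ∈) (All.lookup v≈w γ∈ p))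
    where
    at : ∀ {γ} → γ ∈ Γ → v ⊩ literal w γ ⇔ v γ ≡ w γ
    at γ∈ = ⊩-literal w _ (evalB-Γ γ∈)

  char : Valuation n → Form n
  char = literals U?

  ⊩-char : ∀ {v w} → v ⊩ char w ⇔ v ≈[ U ] w
  ⊩-char = ⊩-literals U?

  Covering : List (Valuation n) → Set
  Covering ws = s ⊢ ⋁ char ws

  valuations-covering : Covering (valuations Γ)
  valuations-covering = consequence [] λ {v} _ →
    ⋁-intro (Any.map (λ e → Equivalence.from ⊩-char (All.tabulate λ γ∈ _ → e γ∈))
                     (valuations-complete Γ v))

  Witness : List (Valuation n) → Valuation n → Subset n → Form n → Set
  Witness ws w B ψ = Any (λ w' → w ≈[ Boxed B ] w' × w' ⊩ ¬ᶠ ψ) ws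

  Witnessed : List (Valuation n) → Valuation n → Form n → Set
  Witnessed ws w (D B ne ψ) = w ⊩ ¬ᶠ D B ne ψ → Witness ws w B ψ
  Witnessed ws w _          = ⊤

  witnessed? : ∀ ws w → Decidable (Witnessed ws w)
  witnessed? ws w (atom _)   = yes tt
  witnessed? ws w (¬ᶠ _)     = yes tt
  witnessed? ws w (_ ∧ᶠ _)   = yes tt
  witnessed? ws w (D B ne ψ) =
    (w ⊩? _) →-dec Any.any? (λ w' → (w ≈[ boxed? B ]? w') ×-dec (w' ⊩? ¬ᶠ ψ)) ws

  unwitnessed⇒⊢D : ∀ {ws w B ψ} .(ne : Nonempty B) → Covering ws → primes ψ ⊆ᴸ Γ →
                   ¬ Witness ws w B ψ → s ⊢ (literals (boxed? B) w ⇒ D B ne ψ)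
  unwitnessed⇒⊢D {ws} {w} {B} {ψ} ne covering ψ⊆Γ unwitnessed =
    ⇒-trans (⋀-persistent B ne {P? = boxed? B} (literal-persistent w B ne) Γ)
            (D-map B ne (consequence (covering ∷ []) λ { (t ∷ []) →
              ⇒-intro λ ls → by-contradiction λ ¬ψ →
                unwitnessed (Any.map (witness ls ¬ψ) (⋁-elim ws t)) }))
    where
    witness : ∀ {v w'} → v ⊩ literals (boxed? B) w → v ⊩ ¬ᶠ ψ → v ⊩ char w' →
              w ≈[ Boxed B ] w' × w' ⊩ ¬ᶠ ψ
    witness {v} {w'} ls ¬ψ c =
      All.zipWith (λ { (w≡ , w'≡) b → trans (sym (w≡ b)) (w'≡ tt) })
        (Equivalence.to (⊩-literals (boxed? B)) ls , v≈w') ,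
      Equivalence.to (⊩-resp-≈ ψ⊆Γ v≈w') ¬ψ
      where
      v≈w' : v ≈[ U ] w'
      v≈w' = Equivalence.to ⊩-char c

  unwitnessed⇒⊢¬char : ∀ {ws w γ} → Covering ws → γ ∈ Γ → ¬ Witnessed ws w γ → s ⊢ (¬ᶠ char w)
  unwitnessed⇒⊢¬char {γ = atom _}   _ _ unwitnessed = contradiction tt unwitnessed
  unwitnessed⇒⊢¬char {γ = ¬ᶠ _}     _ _ unwitnessed = contradiction tt unwitnessed
  unwitnessed⇒⊢¬char {γ = _ ∧ᶠ _}   _ _ unwitnessed = contradiction tt unwitnessed
  unwitnessed⇒⊢¬char {γ = D B ne ψ} covering d∈ unwitnessed =
    consequence (unwitnessed⇒⊢D ne covering (Γ-closed d∈ ∘ there) (unwitnessed ∘ const) ∷ [])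
      λ { (t ∷ []) → ¬-intro λ c →
            let v≈w = Equivalence.to ⊩-char c
                ls  = Equivalence.from (⊩-literals (boxed? B)) (All.map (λ e _ → e tt) v≈w)
                d   = Equivalence.to (⊩-resp-≈ (Γ-closed d∈) v≈w) (⇒-elim t ls)
            in unwitnessed λ ¬d → contradiction d (¬-elim ¬d) }

  Survives : List (Form n) → List (Valuation n) → Valuation n → Set
  Survives Θ ws w = All (w ⊩_) Θ × All (Witnessed ws w) Γ

  survives? : ∀ Θ ws → Decidable (Survives Θ ws)
  survives? Θ ws w = All.all? (w ⊩?_) Θ ×-dec All.all? (witnessed? ws w) Γ

  module _ {Θ} (⊢Θ : All (s ⊢_) Θ) (Θ-primes : ∀ {θ} → θ ∈ Θ → primes θ ⊆ᴸ Γ) where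

    ¬Survives⇒⊢¬char : ∀ {ws w} → Covering ws → ¬ Survives Θ ws w → s ⊢ (¬ᶠ char w)
    ¬Survives⇒⊢¬char {ws} {w} covering ¬survives with All.all? (w ⊩?_) Θ
    ... | no unsound = consequence ⊢Θ λ ts → ¬-intro λ c → unsound (All.tabulate λ θ∈ →
          Equivalence.to (⊩-resp-≈ (Θ-primes θ∈) (Equivalence.to ⊩-char c)) (All.lookup ts θ∈))
    ... | yes sound with find (All.¬All⇒Any¬ (witnessed? ws w) Γ (¬survives ∘ (sound ,_)))
    ...   | _ , γ∈ , unwitnessed = unwitnessed⇒⊢¬char covering γ∈ unwitnessed

    saturation : ∃ λ ws → Covering ws × All (Survives Θ ws) ws
    saturation = stabilise (survives? Θ)
      (λ {ws} covering → ⊢⋁-filter (survives? Θ ws) ws (¬Survives⇒⊢¬char covering) covering)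
      {valuations Γ} valuations-covering

-- The canonical frame

module Canonical {n : ℕ} (s : Variant) (φ₀ : Form n) where

  deadAxiom : (B : Subset n) → .(Nonempty B) → Form n → Form n
  deadAxiom B ne γ = aliveS B ne ∧ᶠ deadS (∁ B) ∧ᶠ γ ⇒ D B ne (deadS (∁ B) ⇒ γ)

  subsetAxioms : (B : Subset n) → .(Nonempty B) → List (Form n)
  subsetAxioms B ne =
    (aliveS B ne ⇒ eachAlive B) ∷ (eachAlive B ⇒ aliveS B ne) ∷ faceAxiom s B ne ∷
    map (deadAxiom B ne) (primes φ₀)

  axioms : List (Form n)
  axioms = someAlive ∷ concatNonempty subsetAxioms

  open TypeElimination s (φ₀ ∷ axioms) public

  boxAxioms : Form n → List (Form n)
  boxAxioms (D B ne ψ) = (¬ᶠ D B ne ψ ⇒ aliveS B ne) ∷ (aliveS B ne ⇒ D B ne ψ ⇒ ψ) ∷ []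
  boxAxioms _          = []

  Θ : List (Form n)
  Θ = axioms ++ concatMap boxAxioms Γ

  ⊢subsetAxioms : ∀ B .(ne : Nonempty B) → All (s ⊢_) (subsetAxioms B ne)
  ⊢subsetAxioms B ne =
    aliveS⇒eachAlive B ne ∷ eachAlive⇒aliveS B (recompute (nonempty? B) ne) ∷ ⊢faceAxiom s B ne ∷
    All.map⁺ (All.tabulate λ {γ} _ → axDead B ne γ)

  ⊢boxAxioms : ∀ γ → All (s ⊢_) (boxAxioms γ)
  ⊢boxAxioms (atom _)   = []
  ⊢boxAxioms (¬ᶠ _)     = []
  ⊢boxAxioms (_ ∧ᶠ _)   = []
  ⊢boxAxioms (D B ne ψ) = ¬D⇒aliveS B ne ψ ∷ aliveS⇒D-reflexive B ne ψ ∷ []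

  ⊢Θ : All (s ⊢_) Θ
  ⊢Θ = All.++⁺ (axAlive ∷ All-concatNonempty⁺ subsetAxioms ⊢subsetAxioms)
               (All.concat⁺ (All.map⁺ {xs = Γ} (All.tabulate λ {γ} _ → ⊢boxAxioms γ)))

  module _ {B : Subset n} (ne : Nonempty B) where

    subsetAxiom∈ : ∀ {θ} → θ ∈ subsetAxioms B ne → θ ∈ axioms
    subsetAxiom∈ i = there (∈-concatNonempty⁺ subsetAxioms ne i)

    aliveS⇒eachAlive∈ : (aliveS B ne ⇒ eachAlive B) ∈ axioms
    aliveS⇒eachAlive∈ = subsetAxiom∈ (here refl)

    eachAlive⇒aliveS∈ : (eachAlive B ⇒ aliveS B ne) ∈ axioms
    eachAlive⇒aliveS∈ = subsetAxiom∈ (there (here refl))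

    faceAxiom∈ : faceAxiom s B ne ∈ axioms
    faceAxiom∈ = subsetAxiom∈ (there (there (here refl)))

    deadAxiom∈ : ∀ {γ} → γ ∈ primes φ₀ → deadAxiom B ne γ ∈ axioms
    deadAxiom∈ γ∈ = subsetAxiom∈ (there (there (there (∈-map⁺ (deadAxiom B ne) γ∈))))

  φ₀-primes : primes φ₀ ⊆ᴸ Γ
  φ₀-primes = Δ-primes (here refl)

  axiom-primes : ∀ {θ} → θ ∈ axioms → primes θ ⊆ᴸ Γ
  axiom-primes i = Δ-primes (there i)

  aliveS-primes : ∀ {B} .(ne : Nonempty B) → primes (aliveS B ne) ⊆ᴸ Γ
  aliveS-primes {B} ne = axiom-primes (aliveS⇒eachAlive∈ (recompute (nonempty? B) ne)) ∘ ∈-++⁺ˡ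

  dead∈Γ : ∀ a → dead a ∈ Γ
  dead∈Γ a = aliveS-primes (a , x∈⁅x⁆ a) (here refl)

  boxAxiom-primes : ∀ {γ θ} → γ ∈ Γ → θ ∈ boxAxioms γ → primes θ ⊆ᴸ Γ
  boxAxiom-primes {D B ne ψ} d∈ (here refl) =
    [ Γ-closed d∈ , aliveS-primes ne ]′ ∘ ∈-++⁻ (primes (D B ne ψ))
  boxAxiom-primes {D B ne ψ} d∈ (there (here refl)) =
    [ aliveS-primes ne , [ Γ-closed d∈ , Γ-closed d∈ ∘ there ]′ ∘ ∈-++⁻ (primes (D B ne ψ)) ]′ ∘
    ∈-++⁻ (primes (aliveS B ne))

  Θ-primes : ∀ {θ} → θ ∈ Θ → primes θ ⊆ᴸ Γ
  Θ-primes θ∈ with ∈-++⁻ axioms θ∈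
  ... | inj₁ i = axiom-primes i
  ... | inj₂ i with find (∈-concatMap⁻ boxAxioms {xs = Γ} i)
  ...   | γ , γ∈ , i' = boxAxiom-primes γ∈ i'

  L : Valuation n → Subset n
  L w = comprehension (λ a → w ⊩? alive a)

  ∈-L : ∀ w {a} → a ∈ˢ L w ⇔ w ⊩ alive a
  ∈-L w = ∈-comprehension (λ a → w ⊩? alive a)

  L⊆⇒⊩deadS-∁ : ∀ {w B} → L w ⊆ˢ B → w ⊩ deadS (∁ B)
  L⊆⇒⊩deadS-∁ {w} {B} L⊆B = deadS-intro (∁ B) λ a∈∁B → by-contradiction λ alive-a →
    x∈∁p⇒x∉p a∈∁B (L⊆B (Equivalence.from (∈-L w) alive-a))

  ⊩deadS-∁⇒L⊆ : ∀ {w B} → w ⊩ deadS (∁ B) → L w ⊆ˢ B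
  ⊩deadS-∁⇒L⊆ {w} {B} t {a} a∈L = decidable-stable (a ∈ˢ? B) λ a∉B →
    ¬-elim (Equivalence.to (∈-L w) a∈L) (deadS-elim (∁ B) t (x∉p⇒x∈∁p a∉B))

  Sound : Valuation n → Set
  Sound w = All (w ⊩_) Θ

  module _ {w} (w-sound : Sound w) where

    axiom-true : ∀ {θ} → θ ∈ axioms → w ⊩ θ
    axiom-true i = All.lookup w-sound (∈-++⁺ˡ i)

    boxAxiom-true : ∀ {γ θ} → γ ∈ Γ → θ ∈ boxAxioms γ → w ⊩ θ
    boxAxiom-true γ∈ i = All.lookup w-sound (∈-++⁺ʳ axioms (∈-concatMap⁺ boxAxioms (lose γ∈ i)))

    L-nonempty : Nonempty (L w)
    L-nonempty with find (⋁-elim (allFin n) (axiom-true (here refl)))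
    ... | a , _ , alive-a = a , Equivalence.from (∈-L w) alive-a

    ⊆L⇒aliveS : ∀ {B} (ne : Nonempty B) → B ⊆ˢ L w → w ⊩ aliveS B ne
    ⊆L⇒aliveS {B} ne B⊆L = ⇒-elim (axiom-true (eachAlive⇒aliveS∈ ne))
      (⋀-intro {P? = _∈ˢ? B} (allFin n) λ _ a∈B → Equivalence.to (∈-L w) (B⊆L a∈B))

    aliveS⇒⊆L : ∀ {B} (ne : Nonempty B) → w ⊩ aliveS B ne → B ⊆ˢ L w
    aliveS⇒⊆L {B} ne t a∈B = Equivalence.from (∈-L w)
      (⋀-elim {P? = _∈ˢ? B} (⇒-elim (axiom-true (aliveS⇒eachAlive∈ ne)) t) (∈-allFin _) a∈B)

    D-reflexive : ∀ {B ψ} .{ne : Nonempty B} → D B ne ψ ∈ Γ → B ⊆ˢ L w → w ⊩ D B ne ψ → w ⊩ ψ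
    D-reflexive {B} {ne = ne} d∈ B⊆L = ⇒-elim
      (⇒-elim (boxAxiom-true d∈ (there (here refl))) (⊆L⇒aliveS (recompute (nonempty? B) ne) B⊆L))

    ¬D⇒⊆L : ∀ {B ψ} .{ne : Nonempty B} → D B ne ψ ∈ Γ → w ⊩ ¬ᶠ D B ne ψ → B ⊆ˢ L w
    ¬D⇒⊆L {B} {ne = ne} d∈ ¬d =
      aliveS⇒⊆L (recompute (nonempty? B) ne) (⇒-elim (boxAxiom-true d∈ (here refl)) ¬d)

  record R (B : Subset n) (w w' : Valuation n) : Set where
    constructor _,_
    field
      dom   : B ⊆ˢ L w
      boxes : w ≈[ Boxed B ] w'

  open R

  R-cod : ∀ {B w w'} → R B w w' → B ⊆ˢ L w'
  R-cod {w = w} {w'} (B⊆L , w≈w') {a} a∈B = Equivalence.from (∈-L w') (¬-intro λ dead-a →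
    ¬-elim (Equivalence.to (∈-L w) (B⊆L a∈B))
           (Equivalence.from (⊩D-resp-≈ (dead∈Γ a) (⁅⁆⊆ a∈B) w≈w') dead-a))

  R-sym : ∀ {B w w'} → R B w w' → R B w' w
  R-sym r = R-cod r , All.map (sym ∘_) (boxes r)

  R-trans : ∀ {B w w' w''} → R B w w' → R B w' w'' → R B w w''
  R-trans (B⊆L , w≈w') (_ , w'≈w'') =
    B⊆L , All.zipWith (λ { (e , e') b → trans (e b) (e' b) }) (w≈w' , w'≈w'')

  R-mono : ∀ {B C w w'} → C ⊆ˢ B → R B w w' → R C w w'
  R-mono C⊆B (B⊆L , w≈w') = B⊆L ∘ C⊆B , All.map (_∘ Boxed-mono C⊆B) w≈w'

  R-box : ∀ {B ψ w w'} .{ne : Nonempty B} → Sound w' → D B ne ψ ∈ Γ → R B w w' →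
          w ⊩ D B ne ψ → w' ⊩ ψ
  R-box w'-sound d∈ r t =
    D-reflexive w'-sound d∈ (R-cod r) (Equivalence.to (⊩D-resp-≈ d∈ id (boxes r)) t)

  R-exact : ∀ {γ w w'} → Sound w → Sound w' → γ ∈ primes φ₀ → R (L w) w w' → L w' ⊆ˢ L w →
            w ⊩ γ → w' ⊩ γ
  R-exact {γ} {w} w-sound w'-sound γ∈ r L⊆ t =
    ⇒-elim (R-box w'-sound box∈Γ r box-true) (L⊆⇒⊩deadS-∁ L⊆)
    where
    ne : Nonempty (L w)
    ne = L-nonempty w-sound

    box∈Γ : D (L w) ne (deadS (∁ (L w)) ⇒ γ) ∈ Γ
    box∈Γ = axiom-primes (deadAxiom∈ ne γ∈)
      (∈-++⁺ʳ (primes (aliveS (L w) ne ∧ᶠ deadS (∁ (L w)) ∧ᶠ γ)) (here refl))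

    box-true : w ⊩ D (L w) ne (deadS (∁ (L w)) ⇒ γ)
    box-true = ⇒-elim (axiom-true w-sound (deadAxiom∈ ne γ∈))
      (∧-intro (⊆L⇒aliveS w-sound ne id) (∧-intro (L⊆⇒⊩deadS-∁ id) t))

  module _ {ws : List (Valuation n)} (ws-survive : All (Survives Θ ws) ws) where

    ws-sound : ∀ {w} → w ∈ ws → Sound w
    ws-sound i = proj₁ (All.lookup ws-survive i)

    frame : Frame n
    frame = record
      { World                  = ∃ (_∈ ws)
      ; live                   = L ∘ proj₁
      ; live-nonempty          = λ { (_ , i) → L-nonempty (ws-sound i) }
      ; R                      = λ B w w' → R B (proj₁ w) (proj₁ w')
      ; R-isPartialEquivalence = λ _ → record { sym = R-sym ; trans = R-trans }
      ; R-dom                  = dom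
      ; R-refl                 = λ B⊆L → B⊆L , All.tabulate λ _ _ → refl
      ; R-mono                 = R-mono
      }

    open Frame frame using (World)

    R-diamond : ∀ {B ψ} .{ne : Nonempty B} (w : World) → D B ne ψ ∈ Γ → proj₁ w ⊩ ¬ᶠ D B ne ψ →
                ∃ λ (w' : World) → R B (proj₁ w) (proj₁ w') × proj₁ w' ⊩ ¬ᶠ ψ
    R-diamond (w , i) d∈ ¬d with find (All.lookup (proj₂ (All.lookup ws-survive i)) d∈ ¬d)
    ... | w' , i' , w≈w' , ¬ψ = (w' , i') , (¬D⇒⊆L (ws-sound i) d∈ ¬d , w≈w') , ¬ψ

    interpretation : Interpretation frame (primes φ₀)
    interpretation = record
      { val     = proj₁
      ; box     = λ { {w' = _ , i'} d∈ → R-box (ws-sound i') (φ₀-primes d∈) }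
      ; diamond = λ {_} {_} {_} {w} d∈ → R-diamond w (φ₀-primes d∈)
      ; exact   = λ { {w = _ , i} {_ , i'} → R-exact (ws-sound i) (ws-sound i') }
      }

    ⊩-everywhere⇒⊢ : Covering ws → (∀ (w : World) → proj₁ w ⊩ φ₀) → s ⊢ φ₀
    ⊩-everywhere⇒⊢ covering φ₀-true = consequence (covering ∷ []) λ { (t ∷ []) →
      let w , i , c = find (⋁-elim ws t)
      in Equivalence.from (⊩-resp-≈ φ₀-primes (Equivalence.to ⊩-char c)) (φ₀-true (w , i)) }

canonical-frameCondition : ∀ s (φ : Form n) → let open Canonical s φ in
                           ∀ {ws} (ws-survive : All (Survives Θ ws) ws) →
                           FrameCondition s (frame ws-survive)
canonical-frameCondition min φ ws-survive (w , i) (w' , i') r =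
  ⊩deadS-∁⇒L⊆ (R-box (ws-sound ws-survive i') box∈Γ r box-true)
  where
  open Canonical min φ

  w-sound : Sound w
  w-sound = ws-sound ws-survive i

  ne : Nonempty (L w)
  ne = L-nonempty w-sound

  box∈Γ : D (L w) ne (deadS (∁ (L w))) ∈ Γ
  box∈Γ = axiom-primes (faceAxiom∈ ne)
    (∈-++⁺ʳ (primes (aliveS (L w) ne ∧ᶠ deadS (∁ (L w)))) (here refl))

  box-true : w ⊩ D (L w) ne (deadS (∁ (L w)))
  box-true = ⇒-elim (axiom-true w-sound (faceAxiom∈ ne))
    (∧-intro (⊆L⇒aliveS w-sound ne id) (L⊆⇒⊩deadS-∁ id))
canonical-frameCondition max φ ws-survive B (w , i) ne B⊆L =
  let w' , r , ¬¬dead = R-diamond ws-survive (w , i) box∈Γ box-false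
  in w' , r , ⊩deadS-∁⇒L⊆ (by-contradiction (¬-elim ¬¬dead))
  where
  open Canonical max φ

  w-sound : Sound w
  w-sound = ws-sound ws-survive i

  box∈Γ : D B ne (¬ᶠ deadS (∁ B)) ∈ Γ
  box∈Γ = axiom-primes (faceAxiom∈ ne) (∈-++⁺ʳ (primes (aliveS B ne)) (here refl))

  box-false : w ⊩ ¬ᶠ D B ne (¬ᶠ deadS (∁ B))
  box-false = ⇒-elim (axiom-true w-sound (faceAxiom∈ ne)) (⊆L⇒aliveS w-sound ne B⊆L)

completeness : ∀ s (φ : Form n) → Valid s φ → s ⊢ φ
completeness s φ valid =
  let ws , covering , ws-survive = saturation ⊢Θ Θ-primes
      φ-true = Valid⇒⊩ s (canonical-frameCondition s φ ws-survive) (interpretation ws-survive) id valid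
  in ⊩-everywhere⇒⊢ ws-survive covering φ-true
  where open Canonical s φ

theorem50 : ∀ {n : ℕ} →
    (∀ (φ : Form n) → ValidMin φ → min ⊢ φ) × (∀ (φ : Form n) → ValidMax φ → max ⊢ φ)
theorem50 = completeness min , completeness max
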